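{- Let $G$ be a finite abelian group of odd order, and let $A\subseteq G$ be non-empty. Suppose that $r_A(d)\ge |A|/2$ for every $d\in A-A$. Then either $A-A$ is a subgroup of $G$, or $A$ is the union of two cosets of a subgroup $H\le G$, that is, there are $x,g\in G$ with $A=(x+H)\cup(x+g+H)$; in the latter case $$A-A=(-g+H)\cup H\cup(g+H),$$ and the image of $g$ in $G/H$ has odd order at least five.
   Context: For a finite non-empty subset $A$ of an abelian group $G$, $A-A=\{a-a':a,a'\in A\}$ and $r_A(d)=|\{(a,a')\in A^2: a-a'=d\}|$ for $d\in G$. The two alternatives are to be read as: either $A-A$ is a subgroup, or there exist $H,x,g$ having all the properties listed in the second alternative. -}

module Defs where

open import Algebra.Bundles using (AbelianGroup)
import Algebra.Properties.AbelianGroup as AbelianGroupProperties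
import Algebra.Properties.Monoid.Mult as Mult
open import Data.Fin.Base using (Fin)
import Data.Fin.Properties as Fin
open import Data.List.Base using (List; tabulate; filter; length; cartesianProduct)
open import Data.Nat.Base using (ℕ; _<_; _≤_)
open import Data.Nat.Divisibility using (_∣_)
open import Data.Product.Base using (_×_; _,_; ∃; ∃₂)
open import Function.Bundles using (Inverse)
open import Function.Properties.Inverse using (Inverse⇒Injection)
open import Level using (Level; _⊔_)
open import Relation.Binary.Bundles using (Setoid)
open import Relation.Binary.Definitions using (_Respects_)
import Relation.Binary.Definitions as Binary
open import Relation.Binary.PropositionalEquality as ≡ using (_≡_)
open import Relation.Nullary.Decidable using (via-injection)
open import Relation.Nullary.Negation using (¬_)
open import Relation.Unary using (Pred; Decidable; _∈_)

Odd : ℕ → Set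
Odd n = ¬ (2 ∣ n)

HasCardinality : ∀ {c ℓ} → Setoid c ℓ → ℕ → Set (c ⊔ ℓ)
HasCardinality S n = Inverse S (≡.setoid (Fin n))

module _ {c ℓ : Level} (G : AbelianGroup c ℓ) where
  open AbelianGroup G using (Carrier; _≈_; monoid)
    renaming (_∙_ to _+_; ε to 0#)
  open Mult monoid renaming (_×_ to _·_)

  record IsOrder (g : Carrier) (k : ℕ) : Set ℓ where
    field
      positive : 0 < k
      kills    : k · g ≈ 0#
      minimal  : ∀ m → 0 < m → m · g ≈ 0# → k ≤ m

module Subsets {c ℓ : Level} (G : AbelianGroup c ℓ) where
  open AbelianGroup G public
    renaming (_∙_ to _+_; ε to 0#; _⁻¹ to -_)
  open AbelianGroupProperties G

  infixl 6 _⊖_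
  _⊖_ : ∀ {p q} → Pred Carrier p → Pred Carrier q → Pred Carrier (c ⊔ ℓ ⊔ p ⊔ q)
  (A ⊖ B) d = ∃₂ λ a b → a ∈ A × b ∈ B × d ≈ a - b

  infixr 7 _+ᶜ_
  _+ᶜ_ : ∀ {p} → Carrier → Pred Carrier p → Pred Carrier (c ⊔ ℓ ⊔ p)
  (x +ᶜ H) y = ∃ λ h → h ∈ H × y ≈ x + h

  record IsSubgroup {p} (H : Pred Carrier p) : Set (c ⊔ ℓ ⊔ p) where
    field
      resp       : H Respects _≈_
      0-closed   : 0# ∈ H
      +-closed   : ∀ {x y} → x ∈ H → y ∈ H → x + y ∈ H
      neg-closed : ∀ {x} → x ∈ H → - x ∈ H

  -- G/H keeps the carrier of G and coarsens its equality to congruence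
  -- modulo H, so the projection G → G/H is the identity on carriers.
  quotient : ∀ {p} {H : Pred Carrier p} → IsSubgroup H → AbelianGroup c p
  quotient {p} {H} H≤G = record
    { Carrier = Carrier
    ; _≈_     = _∼_
    ; _∙_     = _+_
    ; ε       = 0#
    ; _⁻¹     = -_
    ; isAbelianGroup = record
      { isGroup = record
        { isMonoid = record
          { isSemigroup = record
            { isMagma = record
              { isEquivalence = record
                { refl  = ≈⇒∼ refl
                ; sym   = λ {x} {y} x∼y →
                    resp (⁻¹-anti-homo-// x y) (neg-closed x∼y)
                ; trans = λ {x} {y} {z} x∼y y∼z →
                    resp (telescope x y z) (+-closed x∼y y∼z)
                }
              ; ∙-cong = λ {x} {y} {u} {v} x∼y u∼v →
                  resp (interchange x y u v) (+-closed x∼y u∼v)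
              }
            ; assoc = λ x y z → ≈⇒∼ (assoc x y z)
            }
          ; identity = (λ x → ≈⇒∼ (identityˡ x)) , (λ x → ≈⇒∼ (identityʳ x))
          }
        ; inverse = (λ x → ≈⇒∼ (inverseˡ x)) , (λ x → ≈⇒∼ (inverseʳ x))
        ; ⁻¹-cong = λ {x} {y} x∼y →
            resp (sym (⁻¹-∙-comm x (- y))) (neg-closed x∼y)
        }
      ; comm = λ x y → ≈⇒∼ (comm x y)
      }
    }
    where
    open IsSubgroup H≤G
    open import Relation.Binary.Reasoning.Setoid setoid

    _∼_ : Carrier → Carrier → Set p
    x ∼ y = x - y ∈ H

    ≈⇒∼ : ∀ {x y} → x ≈ y → x ∼ y
    ≈⇒∼ {x} {y} x≈y = resp (sym (x≈y⇒x∙y⁻¹≈ε x≈y)) 0-closed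

    telescope : ∀ x y z → (x - y) + (y - z) ≈ x - z
    telescope x y z = begin
      (x - y) + (y - z)    ≈⟨ assoc x (- y) (y - z) ⟩
      x + (- y + (y - z))  ≈⟨ ∙-congˡ (\\-leftDividesʳ y (- z)) ⟩
      x - z                ∎

    interchange : ∀ x y u v → (x - y) + (u - v) ≈ (x + u) - (y + v)
    interchange x y u v = begin
      (x - y) + (u - v)      ≈⟨ medial x (- y) u (- v) ⟩
      (x + u) + (- y + - v)  ≈⟨ ∙-congˡ (⁻¹-∙-comm y v) ⟩
      (x + u) - (y + v)      ∎
      where
      open import Algebra.Properties.CommutativeSemigroup
        (AbelianGroup.commutativeSemigroup G) renaming (interchange to medial)

  module Counting {n : ℕ} (finite : HasCardinality setoid n) where

    infix 4 _≟_
    _≟_ : Binary.Decidable _≈_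
    _≟_ = via-injection (Inverse⇒Injection finite) Fin._≟_

    -- Each element of G occurs exactly once up to _≈_, so the lengths below
    -- are cardinalities.
    elements : List Carrier
    elements = tabulate (Inverse.from finite)

    members : ∀ {p} {A : Pred Carrier p} → Decidable A → List Carrier
    members A? = filter A? elements

    ∣_∣ : ∀ {p} {A : Pred Carrier p} → Decidable A → ℕ
    ∣ A? ∣ = length (members A?)

    r : ∀ {p} {A : Pred Carrier p} → Decidable A → Carrier → ℕ
    r A? d = length (filter (λ (a , a′) → a - a′ ≟ d)
                            (cartesianProduct (members A?) (members A?)))

{-# OPTIONS --safe #-}
module Submission where

-- Let D = A - A, let K be the stabiliser of D, and for x in D let
-- A∩ x = A ∩ (A + x), which has at least half the size of A.  Write x # y when
-- x, y ∈ D but x - y ∉ D.  Then A∩ x and A∩ y are disjoint, hence complementary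
-- halves of A.  Every element of D ∖ K has such a partner, which makes A a union
-- of cosets of K.
--
-- The crucial point is the existence of x # z such that A∩ e is A∩ x or A∩ z for
-- every e ∈ D ∖ K; both halves are then single cosets of K.  If some z has two
-- partners x, y that differ modulo K, any e not # to x, y, z has
-- (A + e) ∩ (A + x) = (A + e) ∩ (A + y), the complement of A + z in A + e, and this
-- forces A∩ e = A∩ x.  If partners are unique modulo K, a parity count shows that
-- 2h ∉ D for h ∈ D ∖ K, so h # - h.  An e ∈ D ∖ K outside ± h + K would then
-- have e ± h ∈ D ∖ K, and since 2e ∉ D the element e + h would have the partners
-- - (e + h) and h - e, whose difference 2h is not in K as the order of G is odd.

open import Defs
open import Algebra.Bundles using (AbelianGroup; CommutativeMonoid; CommutativeRing)
import Algebra.Properties.AbelianGroup as AbelianGroupProperties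
import Algebra.Properties.CommutativeMonoid.Mult as CommutativeMult
import Algebra.Properties.CommutativeMonoid.Sum as CommutativeSum
import Algebra.Properties.Monoid.Mult as Mult
open import Data.Bool.Base using (Bool; true; false; if_then_else_; _∧_; _xor_)
open import Data.Bool.Properties using (xor-∧-commutativeRing; xor-same)
open import Data.Empty using (⊥; ⊥-elim)
open import Data.Fin.Base as Fin using (Fin; zero; suc; toℕ)
import Data.Fin.Properties as Fin
open import Data.Fin.Permutation using (permutation)
open import Data.List.Base as List using (List; []; _∷_; filter; length; map; _++_; cartesianProduct)
import Data.List.Properties as List
open import Data.List.Relation.Unary.All as All using (All; []; _∷_)
import Data.List.Relation.Unary.All.Properties as All
open import Data.List.Relation.Unary.AllPairs using (AllPairs; []; _∷_)
import Data.List.Relation.Unary.AllPairs.Properties as AllPairs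
import Data.List.Relation.Binary.Sublist.Propositional.Properties as Sublist
open import Data.Nat.Base as ℕ using (ℕ; zero; suc; _≤_; _<_; _*_; _∸_; z≤n; s≤s)
open import Data.Nat.Divisibility using (_∣_; divides)
open import Data.Nat.Induction using (<-wellFounded)
import Data.Nat.Properties as ℕ
open import Data.Product.Base using (_×_; Σ-syntax; ∃-syntax; ∃; ∃₂; _,_; proj₁; proj₂)
open import Data.Sum.Base using (_⊎_; inj₁; inj₂; swap; [_,_]′)
open import Data.Vec.Base using (Vec; []; _∷_; lookup; tabulate)
open import Data.Vec.N-ary using (N-ary; _$ⁿ_)
open import Function.Base using (_∘_; const; case_of_)
open import Function.Bundles using (Inverse)
open import Induction.WellFounded using (Acc; acc)
open import Level using (Level; _⊔_)
open import Relation.Binary.Definitions using (_Respects_; tri<; tri≈; tri>)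
open import Relation.Binary.PropositionalEquality as ≡ using (_≡_)
import Relation.Binary.Reasoning.Setoid as SetoidReasoning
open import Relation.Nullary.Decidable
  using (Dec; yes; no; does; True; toWitness; fromWitness; map′; ¬?; _×-dec_; _→-dec_; decidable-stable; dec-true; dec-false)
open import Relation.Nullary.Negation using (¬_; contradiction)
open import Relation.Unary using (Pred; Decidable; Satisfiable; _∈_; _∉_; _⊆_; _≐_; _∪_)
import Relation.Unary.Properties as Unary

-- Deciding linear identities in an abelian group by comparing coefficients.

module Identities {c ℓ : Level} (G : AbelianGroup c ℓ) where
  open AbelianGroup G renaming (_∙_ to _+_; ε to 0#; _⁻¹ to -_)
  open AbelianGroupProperties G
  open CommutativeMult commutativeMonoid using (×-homo-+) renaming (_×_ to _·_)
  open CommutativeSum commutativeMonoid using (sum; ∑-distrib-+; sum-cong-≋; sum-replicate-zero)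
  open import Algebra.Properties.CommutativeSemigroup commutativeSemigroup using (interchange)

  infixl 6 _:+_ _:-_
  infix  8 :-_
  infix  4 _:=_

  data Expr (m : ℕ) : Set where
    var       : Fin m → Expr m
    :0        : Expr m
    _:+_ _:-_ : Expr m → Expr m → Expr m
    :-_       : Expr m → Expr m

  _:=_ : ∀ {m} → Expr m → Expr m → Expr m × Expr m
  _:=_ = _,_

  ⟦_⟧ : ∀ {m} → Expr m → Vec Carrier m → Carrier
  ⟦ var i ⟧  ρ = lookup ρ i
  ⟦ :0 ⟧     ρ = 0#
  ⟦ s :+ t ⟧ ρ = ⟦ s ⟧ ρ + ⟦ t ⟧ ρ
  ⟦ s :- t ⟧ ρ = ⟦ s ⟧ ρ - ⟦ t ⟧ ρ
  ⟦ :- t ⟧   ρ = - ⟦ t ⟧ ρ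

  -- The coefficient of the variable i is (pos t i) - (neg t i).
  pos neg : ∀ {m} → Expr m → Fin m → ℕ
  pos (var i)  j = if does (i Fin.≟ j) then 1 else 0
  pos :0       j = 0
  pos (s :+ t) j = pos s j ℕ.+ pos t j
  pos (s :- t) j = pos s j ℕ.+ neg t j
  pos (:- t)   j = neg t j
  neg (var i)  j = 0
  neg :0       j = 0
  neg (s :+ t) j = neg s j ℕ.+ neg t j
  neg (s :- t) j = neg s j ℕ.+ pos t j
  neg (:- t)   j = pos t j

  combination : ∀ {m} → (Fin m → ℕ) → Vec Carrier m → Carrier
  combination k ρ = sum (λ i → k i · lookup ρ i)

  combination-+ : ∀ {m} (k l : Fin m → ℕ) ρ →
                  combination (λ i → k i ℕ.+ l i) ρ ≈ combination k ρ + combination l ρ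
  combination-+ k l ρ = trans
    (sum-cong-≋ (λ i → ×-homo-+ (lookup ρ i) (k i) (l i)))
    (∑-distrib-+ (λ i → k i · lookup ρ i) (λ i → l i · lookup ρ i))

  combination-0 : ∀ {m} (ρ : Vec Carrier m) → combination (λ _ → 0) ρ ≈ 0#
  combination-0 {m} ρ = sum-replicate-zero m

  combination-var : ∀ {m} (i : Fin m) ρ → combination (pos (var i)) ρ ≈ lookup ρ i
  combination-var zero    (x ∷ ρ) =
    trans (∙-cong (identityʳ x) (combination-0 ρ)) (identityʳ x)
  combination-var (suc i) (x ∷ ρ) =
    trans (identityˡ _) (combination-var i ρ)

  private
    difference-+ : ∀ a b c d → (a - b) + (c - d) ≈ (a + c) - (b + d)
    difference-+ a b c d =
      trans (interchange a (- b) c (- d)) (∙-congˡ (⁻¹-∙-comm b d))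

  ⟦⟧-combination : ∀ {m} (t : Expr m) ρ →
                   ⟦ t ⟧ ρ ≈ combination (pos t) ρ - combination (neg t) ρ
  ⟦⟧-combination (var i) ρ = sym (trans
    (∙-cong (combination-var i ρ) (trans (⁻¹-cong (combination-0 ρ)) ε⁻¹≈ε))
    (identityʳ _))
  ⟦⟧-combination :0 ρ = sym (trans
    (∙-cong (combination-0 ρ) (trans (⁻¹-cong (combination-0 ρ)) ε⁻¹≈ε))
    (identityʳ _))
  ⟦⟧-combination (s :+ t) ρ = begin
    ⟦ s ⟧ ρ + ⟦ t ⟧ ρ  ≈⟨ ∙-cong (⟦⟧-combination s ρ) (⟦⟧-combination t ρ) ⟩
    _                  ≈⟨ difference-+ _ _ _ _ ⟩
    _                  ≈⟨ ∙-cong (combination-+ (pos s) (pos t) ρ)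
                                 (⁻¹-cong (combination-+ (neg s) (neg t) ρ)) ⟨
    _                  ∎
    where open SetoidReasoning setoid
  ⟦⟧-combination (s :- t) ρ = begin
    ⟦ s ⟧ ρ - ⟦ t ⟧ ρ  ≈⟨ ∙-cong (⟦⟧-combination s ρ)
                            (trans (⁻¹-cong (⟦⟧-combination t ρ)) (⁻¹-anti-homo-// _ _)) ⟩
    _                  ≈⟨ difference-+ _ _ _ _ ⟩
    _                  ≈⟨ ∙-cong (combination-+ (pos s) (neg t) ρ)
                                 (⁻¹-cong (combination-+ (neg s) (pos t) ρ)) ⟨
    _                  ∎
    where open SetoidReasoning setoid
  ⟦⟧-combination (:- t) ρ =
    trans (⁻¹-cong (⟦⟧-combination t ρ)) (⁻¹-anti-homo-// _ _)

  -- Equality of the integer coefficients `pos - neg` of both sides, with the subtracted terms moved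
  -- across so that the comparison takes place in ℕ.
  Balanced : ∀ {m} → Expr m × Expr m → Set
  Balanced (s , t) = ∀ i → pos s i ℕ.+ neg t i ≡ pos t i ℕ.+ neg s i

  balanced? : ∀ {m} (e : Expr m × Expr m) → Dec (Balanced e)
  balanced? (s , t) = Fin.all? (λ i → pos s i ℕ.+ neg t i ℕ.≟ pos t i ℕ.+ neg s i)

  private
    cross : ∀ {a b c d} → a + d ≈ c + b → a - b ≈ c - d
    cross {a} {b} {c} {d} a+d≈c+b = begin
      a - b              ≈⟨ ∙-congʳ (x≈z//y a d (c + b) a+d≈c+b) ⟩
      (c + b) - d - b    ≈⟨ assoc _ _ _ ⟩
      c + b + (- d - b)  ≈⟨ interchange c b (- d) (- b) ⟩
      (c - d) + (b - b)  ≈⟨ ∙-congˡ (inverseʳ b) ⟩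
      (c - d) + 0#       ≈⟨ identityʳ _ ⟩
      c - d              ∎
      where open SetoidReasoning setoid

  balanced⇒≈ : ∀ {m} (e : Expr m × Expr m) → Balanced e →
               ∀ ρ → ⟦ proj₁ e ⟧ ρ ≈ ⟦ proj₂ e ⟧ ρ
  balanced⇒≈ (s , t) eq ρ = begin
    ⟦ s ⟧ ρ                                      ≈⟨ ⟦⟧-combination s ρ ⟩
    combination (pos s) ρ - combination (neg s) ρ  ≈⟨ cross (begin
      combination (pos s) ρ + combination (neg t) ρ  ≈⟨ combination-+ (pos s) (neg t) ρ ⟨
      combination (λ i → pos s i ℕ.+ neg t i) ρ
        ≈⟨ sum-cong-≋ (λ i → reflexive (≡.cong (_· lookup ρ i) (eq i))) ⟩
      combination (λ i → pos t i ℕ.+ neg s i) ρ      ≈⟨ combination-+ (pos t) (neg s) ρ ⟩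
      combination (pos t) ρ + combination (neg s) ρ  ∎) ⟩
    combination (pos t) ρ - combination (neg t) ρ  ≈⟨ ⟦⟧-combination t ρ ⟨
    ⟦ t ⟧ ρ                                      ∎
    where open SetoidReasoning setoid

  -- m + 1 variables, so that every instance lives in Set (c ⊔ ℓ) without a Lift.
  Curried : ∀ m → (Vec Carrier (suc m) → Set ℓ) → Set (c ⊔ ℓ)
  Curried zero    P = ∀ x → P (x ∷ [])
  Curried (suc m) P = ∀ x → Curried m (λ ρ → P (x ∷ ρ))

  curried : ∀ m {P : Vec Carrier (suc m) → Set ℓ} → (∀ ρ → P ρ) → Curried m P
  curried zero    f x = f (x ∷ [])
  curried (suc m) f x = curried m (λ ρ → f (x ∷ ρ))

  close : ∀ m → N-ary m (Expr m) (Expr m × Expr m) → Expr m × Expr m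
  close m f = f $ⁿ tabulate var

  -- The argument `m` is one less than the number of variables. For concrete expressions
  -- `True (balanced? e)` evaluates to the unit type, so each use is checked by computation.
  solve : ∀ m (f : N-ary (suc m) (Expr (suc m)) (Expr (suc m) × Expr (suc m))) →
          let e = close (suc m) f in {_ : True (balanced? e)} →
          Curried m (λ ρ → ⟦ proj₁ e ⟧ ρ ≈ ⟦ proj₂ e ⟧ ρ)
  solve m f {ok} = curried m (balanced⇒≈ (close (suc m) f) (toWitness ok))

-- Counting with sums of indicators and with lengths of filtered lists.

private module Sumℕ = CommutativeSum ℕ.+-0-commutativeMonoid
open Sumℕ using () renaming (sum to sumℕ)

sum-mono-≤ : ∀ {m} {f g : Fin m → ℕ} → (∀ i → f i ≤ g i) → sumℕ f ≤ sumℕ g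
sum-mono-≤ {zero}  f≤g = z≤n
sum-mono-≤ {suc m} f≤g = ℕ.+-mono-≤ (f≤g zero) (sum-mono-≤ (f≤g ∘ suc))

sum-mono-< : ∀ {m} {f g : Fin m → ℕ} → (∀ i → f i ≤ g i) → ∀ i → f i < g i → sumℕ f < sumℕ g
sum-mono-< f≤g zero    f<g = ℕ.+-mono-<-≤ f<g (sum-mono-≤ (f≤g ∘ suc))
sum-mono-< f≤g (suc i) f<g = ℕ.+-mono-≤-< (f≤g zero) (sum-mono-< (f≤g ∘ suc) i f<g)

indicator : ∀ {p} {P : Set p} → Dec P → ℕ
indicator P? = if does P? then 1 else 0

indicator-yes : ∀ {p} {P : Set p} (P? : Dec P) → P → indicator P? ≡ 1
indicator-yes P? p rewrite dec-true P? p = ≡.refl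

indicator-no : ∀ {p} {P : Set p} (P? : Dec P) → ¬ P → indicator P? ≡ 0
indicator-no P? ¬p rewrite dec-false P? ¬p = ≡.refl

indicator-mono : ∀ {p q} {P : Set p} {Q : Set q} (P? : Dec P) (Q? : Dec Q) →
                 (P → Q) → indicator P? ≤ indicator Q?
indicator-mono P? Q? P→Q with P?
... | no _  = z≤n
... | yes p rewrite dec-true Q? (P→Q p) = s≤s z≤n

length-filter-tabulate : ∀ {a p} {X : Set a} {P : Pred X p} (P? : Decidable P) {m} (f : Fin m → X) →
                         length (filter P? (List.tabulate f)) ≡ sumℕ (indicator ∘ P? ∘ f)
length-filter-tabulate P? {zero}  f = ≡.refl
length-filter-tabulate P? {suc m} f with ih ← length-filter-tabulate P? (f ∘ suc) | P? (f zero)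
... | yes _ = ≡.cong suc ih
... | no  _ = ih

-- Pairs are counted row by row: the row of `x` contributes at most one pair, and none unless `Q x`
-- holds.
length-filter-cartesianProduct :
  ∀ {a b p q} {X : Set a} {Y : Set b} {P : Pred (X × Y) p} {Q : Pred X q}
  (P? : Decidable P) (Q? : Decidable Q) {xs : List X} {ys : List Y} →
  All (λ x → length (filter (λ y → P? (x , y)) ys) ≤ indicator (Q? x)) xs →
  length (filter P? (cartesianProduct xs ys)) ≤ length (filter Q? xs)
length-filter-cartesianProduct P? Q? [] = z≤n
length-filter-cartesianProduct P? Q? {x ∷ xs} {ys} (bound ∷ bounds) = begin
  length (filter P? (map (x ,_) ys ++ cartesianProduct xs ys))
    ≡⟨ ≡.cong length (List.filter-++ P? (map (x ,_) ys) _) ⟩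
  length (filter P? (map (x ,_) ys) ++ filter P? (cartesianProduct xs ys))
    ≡⟨ List.length-++ (filter P? (map (x ,_) ys)) ⟩
  length (filter P? (map (x ,_) ys)) ℕ.+ length (filter P? (cartesianProduct xs ys))
    ≤⟨ ℕ.+-mono-≤
         (ℕ.≤-trans (ℕ.≤-reflexive (row ys)) bound)
         (length-filter-cartesianProduct P? Q? bounds) ⟩
  indicator (Q? x) ℕ.+ length (filter Q? xs)
    ≡⟨ head ⟩
  length (filter Q? (x ∷ xs)) ∎
  where
  open ℕ.≤-Reasoning
  row : ∀ zs → length (filter P? (map (x ,_) zs)) ≡ length (filter (λ y → P? (x , y)) zs)
  row []       = ≡.refl
  row (z ∷ zs) with does (P? (x , z))
  ... | true  = ≡.cong suc (row zs)
  ... | false = row zs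
  head : indicator (Q? x) ℕ.+ length (filter Q? xs) ≡ length (filter Q? (x ∷ xs))
  head with does (Q? x)
  ... | true  = ≡.refl
  ... | false = ≡.refl

-- The first two entries would be both related and unrelated. With inequality for `R`, a list of
-- distinct entries that all agree is thus seen to have at most one entry.
length≤1 : ∀ {a r} {X : Set a} {R : X → X → Set r} {xs : List X} →
           AllPairs R xs → All (λ x → All (¬_ ∘ R x) xs) xs → length xs ≤ 1
length≤1 {xs = []}        _ _ = z≤n
length≤1 {xs = _ ∷ []}    _ _ = s≤s z≤n
length≤1 {xs = _ ∷ _ ∷ _} ((r ∷ _) ∷ _) ((_ ∷ ¬r ∷ _) ∷ _) = contradiction r ¬r

-- Parity as a sum of Booleans under `xor`.

xor-commutativeMonoid : CommutativeMonoid _ _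
xor-commutativeMonoid = CommutativeRing.+-commutativeMonoid xor-∧-commutativeRing

private module ⊻ = CommutativeSum xor-commutativeMonoid

⊻-false : ∀ {m} {f : Fin m → Bool} → (∀ i → f i ≡ false) → ⊻.sum f ≡ false
⊻-false {m} f≡false = ≡.trans (⊻.sum-cong-≗ f≡false) (⊻.sum-replicate-zero m)

⊻-single : ∀ {m} {f : Fin m → Bool} i → f i ≡ true → (∀ j → f j ≡ true → j ≡ i) →
           ⊻.sum f ≡ true
⊻-single {f = f} zero fi only rewrite fi = ≡.cong (true xor_) (⊻-false rest)
  where
  rest : ∀ j → f (suc j) ≡ false
  rest j with f (suc j) in eq
  ... | false = ≡.refl
  ... | true  = contradiction (only (suc j) eq) λ ()
⊻-single {f = f} (suc i) fi only with f zero in eq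
... | true  = contradiction (only zero eq) λ ()
... | false = ⊻-single i fi (λ j fj → Fin.suc-injective (only (suc j) fj))

⊻-true : ∀ m → ⊻.sum {m} (const true) ≡ false → 2 ∣ m
⊻-true zero          _  = divides 0 ≡.refl
⊻-true (suc zero)    ()
⊻-true (suc (suc m)) eq with ⊻.sum {m} (const true) in sum≡
⊻-true (suc (suc m)) eq | false with divides q m≡q*2 ← ⊻-true m sum≡ =
  divides (suc q) (≡.cong (2 ℕ.+_) m≡q*2)

module _ {m} (π : Fin m → Fin m) (π-involutive : ∀ i → π (π i) ≡ i) where

  -- The points with `i < π i` and those with `π i < i` are exchanged by `π`, so their contributions
  -- cancel and only the fixed points remain.
  ⊻-involution : (f : Fin m → Bool) → (∀ i → f (π i) ≡ f i) →
                 ⊻.sum f ≡ ⊻.sum (λ i → f i ∧ does (π i Fin.≟ i))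
  ⊻-involution f f-π = begin
    ⊻.sum f
      ≡⟨ ⊻.sum-cong-≗ trichotomy ⟩
    ⊻.sum (λ i → (below i xor above i) xor fixed i)
      ≡⟨ ⊻.∑-distrib-+ _ fixed ⟩
    ⊻.sum (λ i → below i xor above i) xor ⊻.sum fixed
      ≡⟨ ≡.cong (_xor ⊻.sum fixed) (⊻.∑-distrib-+ below above) ⟩
    (⊻.sum below xor ⊻.sum above) xor ⊻.sum fixed
      ≡⟨ ≡.cong (λ s → (s xor ⊻.sum above) xor ⊻.sum fixed) swap-sides ⟩
    (⊻.sum above xor ⊻.sum above) xor ⊻.sum fixed
      ≡⟨ ≡.cong (_xor ⊻.sum fixed) (xor-same (⊻.sum above)) ⟩
    ⊻.sum fixed ∎
    where
    open ≡.≡-Reasoning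
    below above fixed : Fin m → Bool
    below i = f i ∧ does (i Fin.<? π i)
    above i = f i ∧ does (π i Fin.<? i)
    fixed i = f i ∧ does (π i Fin.≟ i)

    trichotomy : ∀ i → f i ≡ (below i xor above i) xor fixed i
    trichotomy i with f i
    ... | false = ≡.refl
    ... | true with Fin.<-cmp i (π i)
    ...   | tri< i<πi i≢πi πi≮i
            rewrite dec-true (i Fin.<? π i) i<πi
                  | dec-false (π i Fin.<? i) πi≮i
                  | dec-false (π i Fin.≟ i) (i≢πi ∘ ≡.sym) = ≡.refl
    ...   | tri≈ i≮πi i≡πi πi≮i
            rewrite dec-false (i Fin.<? π i) i≮πi
                  | dec-false (π i Fin.<? i) πi≮i
                  | dec-true (π i Fin.≟ i) (≡.sym i≡πi) = ≡.refl
    ...   | tri> i≮πi i≢πi πi<i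
            rewrite dec-false (i Fin.<? π i) i≮πi
                  | dec-true (π i Fin.<? i) πi<i
                  | dec-false (π i Fin.≟ i) (i≢πi ∘ ≡.sym) = ≡.refl

    swap-sides : ⊻.sum below ≡ ⊻.sum above
    swap-sides = ≡.trans
      (⊻.sum-permute below (permutation π π π-involutive π-involutive))
      (⊻.sum-cong-≗ λ i → ≡.cong₂ _∧_ (f-π i)
        (≡.cong (λ j → does (π i Fin.<? j)) (π-involutive i)))

-- Sizes of subsets of a finite group.

module Finite {c ℓ : Level} (G : AbelianGroup c ℓ) (n : ℕ)
              (finite : HasCardinality (AbelianGroup.setoid G) n) where
  open Subsets G
  open Counting finite
  open Inverse finite using (to; from; to-cong; strictlyInverseˡ; strictlyInverseʳ)

  to-injective : ∀ {x y} → to x ≡ to y → x ≈ y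
  to-injective {x} {y} eq = trans (sym (strictlyInverseʳ x))
    (trans (reflexive (≡.cong from eq)) (strictlyInverseʳ y))

  from-injective : ∀ {i j} → from i ≈ from j → i ≡ j
  from-injective {i} {j} eq = ≡.trans (≡.sym (strictlyInverseˡ i))
    (≡.trans (to-cong eq) (strictlyInverseˡ j))

  ∃? : ∀ {p} {P : Pred Carrier p} → Decidable P → P Respects _≈_ → Dec (∃ P)
  ∃? P? P-resp = map′
    (λ (i , p) → from i , p)
    (λ (x , p) → to x , P-resp (sym (strictlyInverseʳ x)) p)
    (Fin.any? (P? ∘ from))

  ∀? : ∀ {p} {P : Pred Carrier p} → Decidable P → P Respects _≈_ → Dec (∀ x → P x)
  ∀? P? P-resp = map′
    (λ p x → P-resp (strictlyInverseʳ x) (p (to x)))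
    (λ p i → p (from i))
    (Fin.all? (P? ∘ from))

  module _ {φ ψ : Carrier → Carrier}
           (φ-cong : ∀ {x y} → x ≈ y → φ x ≈ φ y) (ψ-cong : ∀ {x y} → x ≈ y → ψ x ≈ ψ y)
           (φ∘ψ : ∀ x → φ (ψ x) ≈ x) where

    index-inverse : ∀ i → to (φ (from (to (ψ (from i))))) ≡ i
    index-inverse i = ≡.trans
      (to-cong (trans (φ-cong (strictlyInverseʳ _)) (φ∘ψ (from i))))
      (strictlyInverseˡ i)

  size : ∀ {p} {P : Pred Carrier p} → Decidable P → ℕ
  size P? = sumℕ (indicator ∘ P? ∘ from)

  module _ {p q} {P : Pred Carrier p} {Q : Pred Carrier q}
           (P? : Decidable P) (Q? : Decidable Q) where

    size-mono-< : P Respects _≈_ → Q Respects _≈_ → P ⊆ Q →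
                  ∀ {x} → x ∈ Q → x ∉ P → size P? < size Q?
    size-mono-< P-resp Q-resp P⊆Q {x} x∈Q x∉P =
      sum-mono-< (λ i → indicator-mono (P? (from i)) (Q? (from i)) P⊆Q) (to x)
        (≡.subst₂ _<_
          (≡.sym (indicator-no (P? x′) (x∉P ∘ P-resp (strictlyInverseʳ x))))
          (≡.sym (indicator-yes (Q? x′) (Q-resp (sym (strictlyInverseʳ x)) x∈Q)))
          (s≤s z≤n))
      where x′ = from (to x)

  module _ {p q r} {P : Pred Carrier p} {Q : Pred Carrier q} {R : Pred Carrier r}
           (P? : Decidable P) (Q? : Decidable Q) (R? : Decidable R)
           (P⊆R : P ⊆ R) (Q⊆R : Q ⊆ R) (disjoint : ∀ {x} → x ∈ P → x ∉ Q) where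
    private
      pointwise : ∀ x → indicator (P? x) ℕ.+ indicator (Q? x) ≤ indicator (R? x)
      pointwise x with P? x
      ... | yes x∈P rewrite indicator-no (Q? x) (disjoint x∈P)
                          | indicator-yes (R? x) (P⊆R x∈P) = s≤s z≤n
      ... | no  _   = indicator-mono (Q? x) (R? x) Q⊆R

      split : size P? ℕ.+ size Q? ≡
              sumℕ (λ i → indicator (P? (from i)) ℕ.+ indicator (Q? (from i)))
      split = ≡.sym (Sumℕ.∑-distrib-+ (indicator ∘ P? ∘ from) (indicator ∘ Q? ∘ from))

    size-disjoint : size P? ℕ.+ size Q? ≤ size R?
    size-disjoint = ℕ.≤-trans (ℕ.≤-reflexive split) (sum-mono-≤ (pointwise ∘ from))

    size-disjoint-< : P Respects _≈_ → Q Respects _≈_ → R Respects _≈_ →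
                      ∀ {x} → x ∈ R → x ∉ P → x ∉ Q → size P? ℕ.+ size Q? < size R?
    size-disjoint-< P-resp Q-resp R-resp {x} x∈R x∉P x∉Q =
      ℕ.≤-<-trans (ℕ.≤-reflexive split) (sum-mono-< (pointwise ∘ from) (to x)
        (≡.subst₂ _<_
          (≡.sym (≡.cong₂ ℕ._+_
            (indicator-no (P? x′) (x∉P ∘ P-resp (strictlyInverseʳ x)))
            (indicator-no (Q? x′) (x∉Q ∘ Q-resp (strictlyInverseʳ x)))))
          (≡.sym (indicator-yes (R? x′) (R-resp (sym (strictlyInverseʳ x)) x∈R)))
          (s≤s z≤n)))
      where x′ = from (to x)

  -- Reindexing the sum along `φ` replaces `P` by its preimage under `φ`, which is contained in `Q`.
  size-bijection : ∀ {p q} {P : Pred Carrier p} {Q : Pred Carrier q}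
                   (P? : Decidable P) (Q? : Decidable Q) → P Respects _≈_ →
                   ∀ {φ ψ : Carrier → Carrier} →
                   (∀ {x y} → x ≈ y → φ x ≈ φ y) → (∀ {x y} → x ≈ y → ψ x ≈ ψ y) →
                   (∀ x → φ (ψ x) ≈ x) → (∀ x → ψ (φ x) ≈ x) →
                   (∀ {x} → φ x ∈ P → x ∈ Q) → size P? ≤ size Q?
  size-bijection P? Q? P-resp {φ} φ-cong ψ-cong φ∘ψ ψ∘φ P⇒Q = ℕ.≤-trans
    (ℕ.≤-reflexive (Sumℕ.sum-permute (indicator ∘ P? ∘ from) (permutation _ _
      (index-inverse φ-cong ψ-cong φ∘ψ) (index-inverse ψ-cong φ-cong ψ∘φ))))
    (sum-mono-≤ λ i → indicator-mono (P? _) (Q? (from i))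
      (P⇒Q ∘ P-resp (strictlyInverseʳ (φ (from i)))))

  ∣∣≡size : ∀ {p} {P : Pred Carrier p} (P? : Decidable P) → ∣ P? ∣ ≡ size P?
  ∣∣≡size P? = length-filter-tabulate P? from

  module _ {p} {A : Pred Carrier p} (A? : Decidable A) (A-resp : A Respects _≈_)
           (d : Carrier) (P? : Decidable (λ a → a ∈ A × a - d ∈ A)) where
    open Identities G

    private
      b≈a-d : ∀ {a b} → a - b ≈ d → b ≈ a - d
      b≈a-d {a} {b} eq = trans (solve 1 (λ a b → b := a :- (a :- b)) a b) (∙-congˡ (⁻¹-cong eq))

      members-distinct : AllPairs _≉_ (members A?)
      members-distinct = AllPairs.filter⁺ A?
        (AllPairs.tabulate⁺ (λ i≢j → i≢j ∘ from-injective))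

      row : ∀ {a} → a ∈ A → length (filter (λ b → a - b ≟ d) (members A?)) ≤ indicator (P? a)
      row {a} a∈A with P? a
      ... | yes _ = length≤1 (AllPairs.filter⁺ E? members-distinct)
                             (All.map (λ e → All.map (λ e′ ¬eq → ¬eq (trans (b≈a-d e) (sym (b≈a-d e′))))
                                                     equal) equal)
        where
        E? = λ b → a - b ≟ d
        equal = All.all-filter E? (members A?)
      ... | no ¬P = ℕ.≤-reflexive (≡.cong length (List.filter-none (λ b → a - b ≟ d)
                      (All.map (λ b∈A eq → ¬P (a∈A , A-resp (b≈a-d eq) b∈A))
                               (All.all-filter A? elements))))

    -- A representation `d = a - b` is determined by `a`, since `b = a - d`, and this element must
    -- again lie in `A`.
    r≤size : r A? d ≤ size P?
    r≤size = begin
      r A? d                          ≤⟨ length-filter-cartesianProduct _ P?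
                                           (All.map row (All.all-filter A? elements)) ⟩
      length (filter P? (members A?)) ≤⟨ Sublist.length-mono-≤
                                           (Sublist.filter⁺ P? P? (λ { ≡.refl p → p })
                                             (Sublist.filter-⊆ A? elements)) ⟩
      length (filter P? elements)     ≡⟨ ∣∣≡size P? ⟩
      size P?                         ∎
      where open ℕ.≤-Reasoning

  -- Parity of the size of a subset, with `true` for odd, and its invariance under involutions.

  parity : ∀ {p} {P : Pred Carrier p} → Decidable P → Bool
  parity P? = ⊻.sum (does ∘ P? ∘ from)

  does-⇔ : ∀ {p q} {P : Set p} {Q : Set q} (P? : Dec P) (Q? : Dec Q) →
           (P → Q) → (Q → P) → does P? ≡ does Q?
  does-⇔ P? Q? P→Q Q→P with P?
  ... | yes p = ≡.sym (dec-true Q? (P→Q p))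
  ... | no ¬p = ≡.sym (dec-false Q? (¬p ∘ Q→P))

  module _ {p} {P : Pred Carrier p} (P? : Decidable P) (P-resp : P Respects _≈_)
           {φ : Carrier → Carrier} (φ-cong : ∀ {x y} → x ≈ y → φ x ≈ φ y)
           (φ∘φ : ∀ x → φ (φ x) ≈ x) (φ-closed : ∀ {x} → x ∈ P → φ x ∈ P) where
    private
      π : Fin n → Fin n
      π i = to (φ (from i))

      fixed⁺ : ∀ {i} → π i ≡ i → φ (from i) ≈ from i
      fixed⁺ eq = trans (sym (strictlyInverseʳ _)) (reflexive (≡.cong from eq))

      parity-fixed : parity P? ≡ ⊻.sum (λ i → does (P? (from i)) ∧ does (π i Fin.≟ i))
      parity-fixed = ⊻-involution π (index-inverse φ-cong φ-cong φ∘φ) (does ∘ P? ∘ from) λ i →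
        does-⇔ (P? (from (π i))) (P? (from i))
          (λ p → P-resp (φ∘φ _) (φ-closed (P-resp (strictlyInverseʳ _) p)))
          (λ p → P-resp (sym (strictlyInverseʳ _)) (φ-closed p))

      fixed⁻ : ∀ i → does (P? (from i)) ∧ does (π i Fin.≟ i) ≡ true →
               from i ∈ P × φ (from i) ≈ from i
      fixed⁻ i eq with P? (from i) | π i Fin.≟ i
      ... | yes p | yes πi≡i = p , fixed⁺ πi≡i
      fixed⁻ i () | yes _ | no _
      fixed⁻ i () | no _  | _

    parity-no-fixed : (∀ {x} → x ∈ P → φ x ≉ x) → parity P? ≡ false
    parity-no-fixed none = ≡.trans parity-fixed (⊻-false not-fixed)
      where
      not-fixed : ∀ i → does (P? (from i)) ∧ does (π i Fin.≟ i) ≡ false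
      not-fixed i with does (P? (from i)) ∧ does (π i Fin.≟ i) in eq
      ... | false = ≡.refl
      ... | true with (p , q) ← fixed⁻ i eq = contradiction q (none p)

    parity-one-fixed : ∀ {h} → h ∈ P → φ h ≈ h → (∀ {x} → x ∈ P → φ x ≈ x → x ≈ h) →
                       parity P? ≡ true
    parity-one-fixed {h} h∈P φh≈h unique = ≡.trans parity-fixed (⊻-single (to h)
      (≡.cong₂ _∧_
        (dec-true (P? _) (P-resp (sym (strictlyInverseʳ h)) h∈P))
        (dec-true (_ Fin.≟ _) (to-cong (trans (φ-cong (strictlyInverseʳ h)) φh≈h))))
      (λ j eq → let (p , q) = fixed⁻ j eq in
        ≡.trans (≡.sym (strictlyInverseˡ j)) (to-cong (unique p q))))

  parity-⊎ : ∀ {p q r} {P : Pred Carrier p} {Q : Pred Carrier q} {R : Pred Carrier r}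
             (P? : Decidable P) (Q? : Decidable Q) (R? : Decidable R) →
             P ⊆ R → Q ⊆ R → (∀ {x} → x ∈ P → x ∉ Q) → (∀ {x} → x ∈ R → x ∉ Q → x ∈ P) →
             parity R? ≡ parity P? xor parity Q?
  parity-⊎ P? Q? R? P⊆R Q⊆R disjoint cover = ≡.trans
    (⊻.sum-cong-≗ (pointwise ∘ from))
    (⊻.∑-distrib-+ (does ∘ P? ∘ from) (does ∘ Q? ∘ from))
    where
    pointwise : ∀ x → does (R? x) ≡ does (P? x) xor does (Q? x)
    pointwise x with P? x | Q? x
    ... | yes x∈P | yes x∈Q = contradiction x∈Q (disjoint x∈P)
    ... | yes x∈P | no  _   = dec-true (R? x) (P⊆R x∈P)
    ... | no  _   | yes x∈Q = dec-true (R? x) (Q⊆R x∈Q)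
    ... | no  x∉P | no  x∉Q = dec-false (R? x) (λ x∈R → x∉P (cover x∈R x∉Q))

-- Groups of odd order: reflections, their centres, and halving.

module OddOrder {c ℓ : Level} (G : AbelianGroup c ℓ) (n : ℕ)
                (finite : HasCardinality (AbelianGroup.setoid G) n) (n-odd : Odd n) where
  open Subsets G
  open Counting finite using (_≟_)
  open Finite G n finite
  open Identities G
  open AbelianGroupProperties G using (x∙y⁻¹≈ε⇒x≈y; x≈y⇒x∙y⁻¹≈ε)

  -- If `x` were non-zero, translation by `x` would be an involution of the whole group without
  -- fixed points, and the order would be even.
  x+x≈0⇒x≈0 : ∀ {x} → x + x ≈ 0# → x ≈ 0#
  x+x≈0⇒x≈0 {x} x+x≈0 with x ≟ 0#
  ... | yes x≈0 = x≈0
  ... | no  x≉0 = contradiction (⊻-true n (parity-no-fixed Unary.U? (λ _ u → u)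
    {φ = _+ x} ∙-congʳ
    (λ a → trans (assoc a x x) (trans (∙-congˡ x+x≈0) (identityʳ a)))
    (λ u → u)
    (λ {a} _ a+x≈a → x≉0 (trans (solve 1 (λ a x → x := (a :+ x) :- a) a x)
                                 (x≈y⇒x∙y⁻¹≈ε a+x≈a))))) n-odd

  doubling-injective : ∀ {x y} → x + x ≈ y + y → x ≈ y
  doubling-injective {x} {y} eq = x∙y⁻¹≈ε⇒x≈y x y (x+x≈0⇒x≈0 (trans
    (solve 1 (λ x y → (x :- y) :+ (x :- y) := (x :+ x) :- (y :+ y)) x y)
    (x≈y⇒x∙y⁻¹≈ε eq)))

  module _ {p} {P : Pred Carrier p} (P? : Decidable P) (P-resp : P Respects _≈_)
           {c : Carrier} (symmetric : ∀ {x} → x ∈ P → c - x ∈ P) where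
    private
      reflect-cong : ∀ {x y} → x ≈ y → c - x ≈ c - y
      reflect-cong = ∙-congˡ ∘ ⁻¹-cong

      reflect-involutive : ∀ x → c - (c - x) ≈ x
      reflect-involutive = solve 1 (λ c x → c :- (c :- x) := x) c

      fixed⇒centre : ∀ {x} → c - x ≈ x → x + x ≈ c
      fixed⇒centre {x} eq = trans (∙-congʳ (sym eq)) (solve 1 (λ c x → (c :- x) :+ x := c) c x)

    -- The reflection `x ↦ c - x` fixes exactly the solutions of `x + x = c`, and in odd order there
    -- is at most one; here it is `h`.
    parity-centred : ∀ {h} → h ∈ P → h + h ≈ c → parity P? ≡ true
    parity-centred {h} h∈P 2h≈c = parity-one-fixed P? P-resp reflect-cong reflect-involutive symmetric
      h∈P
      (trans (∙-congʳ (sym 2h≈c)) (solve 0 (λ h → (h :+ h) :- h := h) h))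
      (λ _ eq → doubling-injective (trans (fixed⇒centre eq) (sym 2h≈c)))

    parity-uncentred : (∀ {x} → x ∈ P → x + x ≉ c) → parity P? ≡ false
    parity-uncentred none = parity-no-fixed P? P-resp reflect-cong reflect-involutive symmetric
      (λ x∈P → none x∈P ∘ fixed⇒centre)

  -- Both centres of symmetry force the same parity of the size of P.
  common-centre : ∀ {p} {P : Pred Carrier p} → Decidable P → P Respects _≈_ →
                  ∀ {c c′} → (∀ {x} → x ∈ P → c - x ∈ P) → (∀ {x} → x ∈ P → c′ - x ∈ P) →
                  ∀ {h} → h ∈ P → h + h ≈ c → ∃ λ h′ → h′ ∈ P × h′ + h′ ≈ c′
  common-centre P? P-resp {c} {c′} sym-c sym-c′ h∈P 2h≈c
    with ∃? (λ x → P? x ×-dec (x + x ≟ c′))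
            (λ x≈y (p , q) → P-resp x≈y p , trans (∙-cong (sym x≈y) (sym x≈y)) q)
  ... | yes centre = centre
  ... | no  none   = contradiction
    (≡.trans (≡.sym (parity-centred P? P-resp sym-c h∈P 2h≈c))
             (parity-uncentred P? P-resp sym-c′ (λ p q → none (_ , p , q))))
    λ ()

  module _ {p} {H : Pred Carrier p} (H? : Decidable H) (H≤G : IsSubgroup H) where
    open IsSubgroup H≤G

    -- The coset `h + H` is symmetric under `a ↦ 2h - a`, and under `a ↦ - a` because `2h` lies in
    -- `H`. It contains `h`, the centre of the first reflection, so by `common-centre` it contains a
    -- solution of `x + x = 0`, which can only be zero.
    halve : ∀ {h} → h + h ∈ H → h ∈ H
    halve {h} 2h∈H with x , x-h∈H , 2x≈0 ← common-centre
        (λ a → H? (a - h)) (λ a≈b → resp (∙-congʳ a≈b))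
        {c = h + h} {c′ = 0#}
        (λ {a} a-h∈H → resp (solve 1 (λ a h → :- (a :- h) := ((h :+ h) :- a) :- h) a h) (neg-closed a-h∈H))
        (λ {a} a-h∈H → resp (solve 1 (λ a h → :- ((a :- h) :+ (h :+ h)) := (:0 :- a) :- h) a h)
                            (neg-closed (+-closed a-h∈H 2h∈H)))
        (resp (sym (inverseʳ h)) 0-closed) refl =
      resp (trans (⁻¹-cong (∙-congʳ (x+x≈0⇒x≈0 2x≈0)))
                  (solve 0 (λ h → :- (:0 :- h) := h) h))
           (neg-closed x-h∈H)

-- Orders of elements.

least : ∀ {p} {P : Pred ℕ p} → Decidable P → ∀ {k} → 0 < k → P k →
        ∃ λ l → 0 < l × P l × (∀ m → 0 < m → P m → l ≤ m)
least {P = P} P? {k} 0<k Pk = go (<-wellFounded k) 0<k Pk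
  where
  go : ∀ {k} → Acc _<_ k → 0 < k → P k → ∃ λ l → 0 < l × P l × (∀ m → 0 < m → P m → l ≤ m)
  go {k} (acc rec) 0<k Pk with ℕ.anyUpTo? (λ m → (0 ℕ.<? m) ×-dec P? m) k
  ... | yes (m , m<k , 0<m , Pm) = go (rec m<k) 0<m Pm
  ... | no  none = k , 0<k , Pk , λ m 0<m Pm → ℕ.≮⇒≥ λ m<k → none (m , m<k , 0<m , Pm)

module Orders {c ℓ : Level} (Q : AbelianGroup c ℓ) where
  open AbelianGroup Q renaming (_∙_ to _+_; ε to 0#)
  open Mult monoid using (×-homo-+) renaming (_×_ to _·_)
  open AbelianGroupProperties Q using (∙-cancelˡ)

  -- Among the first `n + 1` multiples of `g` two have the same image under `f`, and their
  -- difference yields a positive period, hence a least one. Stated for a map that reflects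
  -- equality, so that the enumeration of a group serves for its quotients.
  order-exists : ∀ {n} (f : Carrier → Fin n) → (∀ {x y} → f x ≡ f y → x ≈ y) →
                 (∀ x → Dec (x ≈ 0#)) → ∀ g → ∃ (IsOrder Q g)
  order-exists {n} f f-injective ≈0? g
    with i , j , i<j , eq ← Fin.pigeonhole (ℕ.n<1+n n) (λ i → f (toℕ i · g)) =
    let (k , 0<k , kills , minimal) = least (λ k → ≈0? (k · g)) (ℕ.m<n⇒0<n∸m i<j) period
    in k , record { positive = 0<k ; kills = kills ; minimal = minimal }
    where
    period : (toℕ j ∸ toℕ i) · g ≈ 0#
    period = ∙-cancelˡ (toℕ i · g) _ _ (begin
      toℕ i · g + (toℕ j ∸ toℕ i) · g    ≈⟨ ×-homo-+ g (toℕ i) (toℕ j ∸ toℕ i) ⟨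
      (toℕ i ℕ.+ (toℕ j ∸ toℕ i)) · g    ≡⟨ ≡.cong (_· g) (ℕ.m+[n∸m]≡n (ℕ.<⇒≤ i<j)) ⟩
      toℕ j · g                          ≈⟨ f-injective eq ⟨
      toℕ i · g                          ≈⟨ identityʳ _ ⟨
      toℕ i · g + 0#                     ∎)
      where open SetoidReasoning setoid

  module _ {g k} (order : IsOrder Q g k) where
    open IsOrder order

    -- If `k = 2q`, then doubling `q · g` gives zero, so `q · g` is itself zero, against the
    -- minimality of `k`.
    order-odd : (∀ {x} → x + x ≈ 0# → x ≈ 0#) → Odd k
    order-odd 2-torsion-free (divides zero    ≡.refl) = ℕ.n≮n 0 positive
    order-odd 2-torsion-free (divides (suc q) ≡.refl) =
      ℕ.n≮n (suc q) (ℕ.<-≤-trans (ℕ.m<m*n (suc q) 2 (s≤s (s≤s z≤n)))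
        (minimal (suc q) (s≤s z≤n) (2-torsion-free (begin
          suc q · g + suc q · g      ≈⟨ ×-homo-+ g (suc q) (suc q) ⟨
          (suc q ℕ.+ suc q) · g      ≡⟨ ≡.cong (_· g) (double (suc q)) ⟩
          (suc q * 2) · g            ≈⟨ kills ⟩
          0#                         ∎))))
      where
      open SetoidReasoning setoid
      double : ∀ q → q ℕ.+ q ≡ q * 2
      double q = ≡.trans (≡.cong (q ℕ.+_) (≡.sym (ℕ.+-identityʳ q))) (ℕ.*-comm 2 q)

    order≥5 : Odd k → g ≉ 0# → ¬ (3 · g ≈ 0#) → 5 ≤ k
    order≥5 k-odd g≉0 3g≉0 = go k k-odd positive kills
      where
      go : ∀ k → Odd k → 0 < k → k · g ≈ 0# → 5 ≤ k
      go 1 _   _ 1g≈0 = contradiction (trans (sym (identityʳ g)) 1g≈0) g≉0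
      go 2 odd _ _    = contradiction (divides 1 ≡.refl) odd
      go 3 _   _ 3g≈0 = contradiction 3g≈0 3g≉0
      go 4 odd _ _    = contradiction (divides 2 ≡.refl) odd
      go (suc (suc (suc (suc (suc k))))) _ _ _ = s≤s (s≤s (s≤s (s≤s (s≤s z≤n))))

-- The difference set and the halves `A∩ x`.

module HalfPopular
  {c ℓ p : Level} (G : AbelianGroup c ℓ) (n : ℕ)
  (finite : HasCardinality (AbelianGroup.setoid G) n) (n-odd : Odd n)
  (A : Pred (AbelianGroup.Carrier G) p) (A? : Decidable A)
  (A-resp : A Respects (AbelianGroup._≈_ G)) (A-nonempty : Satisfiable A)
  (half : ∀ d → Subsets._⊖_ G A A d →
          Subsets.Counting.∣_∣ G finite A? ≤ 2 * Subsets.Counting.r G finite A? d)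
  where
  open Subsets G
  open Counting finite
  open Finite G n finite
  open OddOrder G n finite n-odd
  open Identities G

  D : Pred Carrier (c ⊔ ℓ ⊔ p)
  D = A ⊖ A

  D-resp : D Respects _≈_
  D-resp x≈y (a , b , a∈A , b∈A , x≈a-b) = a , b , a∈A , b∈A , trans (sym x≈y) x≈a-b

  D? : Decidable D
  D? d = ∃?
    (λ a → ∃? (λ b → A? a ×-dec A? b ×-dec (d ≟ a - b))
              (λ b≈b′ (a∈A , b∈A , eq) →
                a∈A , A-resp b≈b′ b∈A , trans eq (∙-congˡ (⁻¹-cong b≈b′))))
    (λ a≈a′ (b , a∈A , b∈A , eq) → b , A-resp a≈a′ a∈A , b∈A , trans eq (∙-congʳ a≈a′))

  difference∈D : ∀ {a b} → a ∈ A → b ∈ A → a - b ∈ D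
  difference∈D a∈A b∈A = _ , _ , a∈A , b∈A , refl

  D-neg : ∀ {x} → x ∈ D → - x ∈ D
  D-neg (a , b , a∈A , b∈A , eq) = b , a , b∈A , a∈A ,
    trans (⁻¹-cong eq) (solve 1 (λ a b → :- (a :- b) := b :- a) a b)

  0∈D : 0# ∈ D
  0∈D = let (a , a∈A) = A-nonempty in D-resp (inverseʳ a) (difference∈D a∈A a∈A)

  A∩ : Carrier → Pred Carrier p
  A∩ x a = a ∈ A × a - x ∈ A

  A∩? : ∀ x → Decidable (A∩ x)
  A∩? x a = A? a ×-dec A? (a - x)

  A∩-resp : ∀ {x} → A∩ x Respects _≈_
  A∩-resp a≈b (a∈A , a-x∈A) = A-resp a≈b a∈A , A-resp (∙-congʳ a≈b) a-x∈A

  infix 4 _#_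
  _#_ : Carrier → Carrier → Set (c ⊔ ℓ ⊔ p)
  x # y = x ∈ D × y ∈ D × x - y ∉ D

  #-sym : ∀ {x y} → x # y → y # x
  #-sym {x} {y} (x∈D , y∈D , x-y∉D) = y∈D , x∈D , λ y-x∈D →
    x-y∉D (D-resp (solve 1 (λ x y → :- (y :- x) := x :- y) x y) (D-neg y-x∈D))

  #-neg : ∀ {x y} → x # y → - x # - y
  #-neg {x} {y} (x∈D , y∈D , x-y∉D) = D-neg x∈D , D-neg y∈D , λ d →
    x-y∉D (D-resp (solve 1 (λ x y → :- (:- x :- :- y) := x :- y) x y) (D-neg d))

  -- If `a - x` and `a - y` were both in `A`, then `x - y` would be a difference of two elements of
  -- `A`.
  disjoint : ∀ {x y a} → x # y → a ∈ A∩ x → a ∉ A∩ y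
  disjoint {x} {y} {a} (_ , _ , x-y∉D) (_ , a-x∈A) (_ , a-y∈A) =
    x-y∉D (D-resp (solve 2 (λ x y a → (a :- y) :- (a :- x) := x :- y) x y a)
                  (difference∈D a-y∈A a-x∈A))

  size-A∩-≥ : ∀ {x} → x ∈ D → size A? ≤ 2 * size (A∩? x)
  size-A∩-≥ {x} x∈D = begin
    size A?             ≡⟨ ∣∣≡size A? ⟨
    ∣ A? ∣              ≤⟨ half x x∈D ⟩
    2 * r A? x          ≤⟨ ℕ.*-monoʳ-≤ 2 (r≤size A? A-resp x (A∩? x)) ⟩
    2 * size (A∩? x)    ∎
    where open ℕ.≤-Reasoning

  private
    2*-sum-≥ : ∀ {x y} → x ∈ D → y ∈ D → 2 * size A? ≤ 2 * (size (A∩? x) ℕ.+ size (A∩? y))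
    2*-sum-≥ {x} {y} x∈D y∈D = begin
      2 * size A?                                ≡⟨ ≡.cong (size A? ℕ.+_) (ℕ.+-identityʳ _) ⟩
      size A? ℕ.+ size A?                        ≤⟨ ℕ.+-mono-≤ (size-A∩-≥ x∈D) (size-A∩-≥ y∈D) ⟩
      2 * size (A∩? x) ℕ.+ 2 * size (A∩? y)      ≡⟨ ℕ.*-distribˡ-+ 2 (size (A∩? x)) _ ⟨
      2 * (size (A∩? x) ℕ.+ size (A∩? y))        ∎
      where open ℕ.≤-Reasoning

  -- Two disjoint subsets of `A`, each with at least half of its elements, leave no element of `A`
  -- over.
  cover : ∀ {x y a} → x # y → a ∈ A → a ∈ A∩ x ⊎ a ∈ A∩ y
  cover {x} {y} {a} x#y@(x∈D , y∈D , _) a∈A with A∩? x a | A∩? y a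
  ... | yes a∈A∩x | _         = inj₁ a∈A∩x
  ... | no  _     | yes a∈A∩y = inj₂ a∈A∩y
  ... | no  a∉A∩x | no a∉A∩y  = contradiction (2*-sum-≥ x∈D y∈D) (ℕ.<⇒≱ (ℕ.*-monoʳ-< 2
    (size-disjoint-< (A∩? x) (A∩? y) A? proj₁ proj₁ (disjoint x#y)
                     A∩-resp A∩-resp A-resp a∈A a∉A∩x a∉A∩y)))

  -- The disjoint set `A∩ y` already takes up at least half of `A`.
  size-A∩-≤ : ∀ {x y} → x # y → 2 * size (A∩? x) ≤ size A?
  size-A∩-≤ {x} {y} x#y@(_ , y∈D , _) = ℕ.+-cancelʳ-≤ (size A?) _ _ (begin
    2 * size (A∩? x) ℕ.+ size A?            ≤⟨ ℕ.+-monoʳ-≤ (2 * size (A∩? x)) (size-A∩-≥ y∈D) ⟩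
    2 * size (A∩? x) ℕ.+ 2 * size (A∩? y)   ≡⟨ ℕ.*-distribˡ-+ 2 (size (A∩? x)) _ ⟨
    2 * (size (A∩? x) ℕ.+ size (A∩? y))     ≤⟨ ℕ.*-monoʳ-≤ 2
      (size-disjoint (A∩? x) (A∩? y) A? proj₁ proj₁ (disjoint x#y)) ⟩
    2 * size A?                             ≡⟨ ≡.cong (size A? ℕ.+_) (ℕ.+-identityʳ _) ⟩
    size A? ℕ.+ size A?                     ∎)
    where open ℕ.≤-Reasoning

  -- Both sets have exactly half the size of A, so an inclusion between
  -- translates is an equality.
  rigid : ∀ {x y w t} → x ∈ D → y # w → (∀ {a} → a ∈ A∩ x → a + t ∈ A∩ y) →
          ∀ {b} → b ∈ A∩ y → b - t ∈ A∩ x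
  rigid {x} {y} {w} {t} x∈D y#w shift {b} b∈A∩y with A∩? x (b - t)
  ... | yes b-t∈A∩x = b-t∈A∩x
  ... | no  b-t∉A∩x = contradiction
    (ℕ.≤-trans (size-A∩-≤ y#w) (size-A∩-≥ x∈D))
    (ℕ.<⇒≱ (ℕ.*-monoʳ-< 2 (ℕ.≤-<-trans
      (size-bijection (A∩? x) shifted? A∩-resp ∙-congʳ ∙-congʳ
        (solve 1 (λ t a → (a :+ t) :- t := a) t) (-t+t t) (λ q → q))
      (size-mono-< shifted? (A∩? y) (λ a≈b → A∩-resp (∙-congʳ a≈b)) A∩-resp
        (λ q → A∩-resp (-t+t t _) (shift q)) b∈A∩y b-t∉A∩x))))
    where
    shifted? = λ a → A∩? x (a - t)
    -t+t = solve 1 (λ t a → (a :- t) :+ t := a)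

  -- Both sets are the complement of `A∩ z` in `A`.
  common-partner : ∀ {x y z} → x # z → y # z → A∩ x ⊆ A∩ y
  common-partner x#z y#z a∈A∩x =
    [ (λ a∈A∩y → a∈A∩y)
    , (λ a∈A∩z → contradiction a∈A∩z (disjoint x#z a∈A∩x))
    ]′ (cover y#z (proj₁ a∈A∩x))

  common-partner-≐ : ∀ {x y z} → x # z → y # z → A∩ x ≐ A∩ y
  common-partner-≐ x#z y#z = common-partner x#z y#z , common-partner y#z x#z

  -- The stabiliser of the difference set.

  -- Asking for both signs makes closure under negation immediate.
  Stabilises : Pred Carrier (c ⊔ ℓ ⊔ p)
  Stabilises h = ∀ x → x ∈ D → x + h ∈ D × x - h ∈ D

  stabilises? : Decidable Stabilises
  stabilises? h = ∀? (λ x → D? x →-dec (D? (x + h) ×-dec D? (x - h)))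
    (λ x≈y f y∈D → let (u , v) = f (D-resp (sym x≈y) y∈D) in
      D-resp (∙-congʳ x≈y) u , D-resp (∙-congʳ x≈y) v)

  -- The stabiliser of D, squashed into the universe of A.
  record K (h : Carrier) : Set p where
    no-eta-equality
    constructor stabiliser
    field stabilises : True (stabilises? h)

  open K

  K? : Decidable K
  K? h = map′ (stabiliser ∘ fromWitness) (toWitness ∘ stabilises) (stabilises? h)

  K-intro : ∀ {h} → (∀ {x} → x ∈ D → x + h ∈ D) → (∀ {x} → x ∈ D → x - h ∈ D) → h ∈ K
  K-intro plus minus = stabiliser (fromWitness λ _ x∈D → plus x∈D , minus x∈D)

  D+K : ∀ {x h} → x ∈ D → h ∈ K → x + h ∈ D
  D+K x∈D h∈K = proj₁ (toWitness (stabilises h∈K) _ x∈D)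

  D-K : ∀ {x h} → x ∈ D → h ∈ K → x - h ∈ D
  D-K x∈D h∈K = proj₂ (toWitness (stabilises h∈K) _ x∈D)

  K⊆D : K ⊆ D
  K⊆D h∈K = D-resp (identityˡ _) (D+K 0∈D h∈K)

  K≤G : IsSubgroup K
  K≤G = record
    { resp       = λ h≈k h∈K → K-intro
        (λ x∈D → D-resp (∙-congˡ h≈k) (D+K x∈D h∈K))
        (λ x∈D → D-resp (∙-congˡ (⁻¹-cong h≈k)) (D-K x∈D h∈K))
    ; 0-closed   = K-intro
        (D-resp (solve 0 (λ x → x := x :+ :0) _))
        (D-resp (solve 0 (λ x → x := x :- :0) _))
    ; +-closed   = λ h∈K k∈K → K-intro
        (λ x∈D → D-resp (assoc _ _ _) (D+K (D+K x∈D h∈K) k∈K))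
        (λ x∈D → D-resp (solve 2 (λ x h k → (x :- h) :- k := x :- (h :+ k)) _ _ _)
                        (D-K (D-K x∈D h∈K) k∈K))
    ; neg-closed = λ h∈K → K-intro
        (λ x∈D → D-K x∈D h∈K)
        (λ x∈D → D-resp (solve 1 (λ x h → x :+ h := x :- (:- h)) _ _) (D+K x∈D h∈K))
    }

  open IsSubgroup K≤G public
    renaming (resp to K-resp; 0-closed to 0∈K; +-closed to K-+; neg-closed to K-neg)

  D⊆K⇒subgroup : D ⊆ K → IsSubgroup D
  D⊆K⇒subgroup D⊆K = record
    { resp       = D-resp
    ; 0-closed   = 0∈D
    ; +-closed   = λ x∈D y∈D → D+K x∈D (D⊆K y∈D)
    ; neg-closed = D-neg
    }

  -- Partners, and periodicity of `A` modulo the stabiliser.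

  #-shift : ∀ {x y k} → x # y → k ∈ K → x - k # y
  #-shift {x} {y} {k} (x∈D , y∈D , x-y∉D) k∈K = D-K x∈D k∈K , y∈D , λ d →
    x-y∉D (D-resp (solve 2 (λ x y k → ((x :- k) :- y) :+ k := x :- y) x y k) (D+K d k∈K))

  #? : ∀ x y → Dec (x # y)
  #? x y = D? x ×-dec D? y ×-dec ¬? (D? (x - y))

  #-resp : ∀ {x y x′ y′} → x ≈ x′ → y ≈ y′ → x # y → x′ # y′
  #-resp x≈x′ y≈y′ (x∈D , y∈D , x-y∉D) = D-resp x≈x′ x∈D , D-resp y≈y′ y∈D ,
    λ d → x-y∉D (D-resp (∙-cong (sym x≈x′) (⁻¹-cong (sym y≈y′))) d)

  not-#⇒difference : ∀ {x y} → x ∈ D → y ∈ D → ¬ x # y → x - y ∈ D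
  not-#⇒difference x∈D y∈D ¬x#y = decidable-stable (D? _) λ x-y∉D → ¬x#y (x∈D , y∈D , x-y∉D)

  -- Without a partner, `x - y` lies in `D` for every `y` in `D`. Since `D` is symmetric,
  -- translation by `x` and by `- x` then preserves `D`, which puts `x` in `K`.
  partner : ∀ {x} → x ∈ D → x ∉ K → ∃ λ y → x # y
  partner {x} x∈D x∉K = decidable-stable (∃? (#? x) (#-resp refl)) λ alone →
    let x-D : ∀ {y} → y ∈ D → x - y ∈ D
        x-D y∈D = not-#⇒difference x∈D y∈D (λ x#y → alone (_ , x#y))
    in x∉K (K-intro
      (λ {y} y∈D → D-resp (solve 1 (λ x y → x :- :- y := y :+ x) x y) (x-D (D-neg y∈D)))
      (λ {y} y∈D → D-resp (solve 1 (λ x y → :- (x :- y) := y :- x) x y) (D-neg (x-D y∈D))))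

  module Periodic {x₀ y₀} (x₀#y₀ : x₀ # y₀) where

    A+K : ∀ {a k} → a ∈ A → k ∈ K → a + k ∈ A
    A+K {a} {k} a∈A k∈K = [ via x₀#y₀ , via (#-sym x₀#y₀) ]′ (cover x₀#y₀ a∈A)
      where
      -- The complement of A∩ (- y) is both A∩ (- x) and A∩ (- x - k).
      via : ∀ {x y} → x # y → a ∈ A∩ x → a + k ∈ A
      via {x} {y} x#y (_ , a-x∈A) =
        [ (λ (_ , a+k∈A) →
             A-resp (solve 2 (λ a x k → (a :- x) :- (:- x :- k) := a :+ k) a x k) a+k∈A)
        , (λ a-x∈A∩-y → contradiction a-x∈A∩-y (disjoint (#-neg x#y)
             (a-x∈A , A-resp (solve 1 (λ a x → a := (a :- x) :- :- x) a x) a∈A)))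
        ]′ (cover (#-shift (#-neg x#y) k∈K) a-x∈A)

    A∩-congruent : ∀ {x y} → x - y ∈ K → A∩ x ⊆ A∩ y
    A∩-congruent {x} {y} x-y∈K {a} (a∈A , a-x∈A) =
      a∈A , A-resp (solve 2 (λ a x y → (a :- x) :+ (x :- y) := a :- y) a x y) (A+K a-x∈A x-y∈K)

    A∩-≐ : ∀ {x y} → x - y ∈ K → A∩ x ≐ A∩ y
    A∩-≐ {x} {y} x-y∈K = A∩-congruent x-y∈K ,
      A∩-congruent (K-resp (solve 1 (λ x y → :- (x :- y) := y :- x) x y) (K-neg x-y∈K))

  -- The dichotomy when some element has two partners that differ modulo `K`.

  Dichotomy : Carrier → Carrier → Set (c ⊔ ℓ ⊔ p)
  Dichotomy x z = x # z × (∀ {e} → e ∈ D → e ∉ K → A∩ e ≐ A∩ x ⊎ A∩ e ≐ A∩ z)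

  two-partners⇒dichotomy : ∀ {x y z} → x # z → y # z → x - y ∉ K → Dichotomy x z
  two-partners⇒dichotomy {x} {y} {z} x#z@(x∈D , z∈D , x-z∉D) y#z@(y∈D , _ , y-z∉D) x-y∉K =
    x#z , dichotomy
    where
    -- If `y # x`, the sets `A∩ x` and `A∩ y` would be disjoint and cover `A`; but they coincide,
    -- both being the complement of `A∩ z`, so `A` would be empty.
    y-x∈D : y - x ∈ D
    y-x∈D = not-#⇒difference y∈D x∈D λ y#x →
      let (a , a∈A) = A-nonempty in
      [ (λ a∈A∩x → disjoint y#x (common-partner x#z y#z a∈A∩x) a∈A∩x)
      , (λ a∈A∩y → disjoint y#x a∈A∩y (common-partner y#z x#z a∈A∩y))
      ]′ (cover (#-sym y#x) a∈A)

    y-x∉K : y - x ∉ K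
    y-x∉K k = x-y∉K (K-resp (solve 1 (λ x y → :- (y :- x) := x :- y) x y) (K-neg k))

    -- A∩ y-x is the translate of A∩ x = A∩ y by - x.
    A∩[y-x]+x : ∀ {b} → b ∈ A∩ (y - x) → b + x ∈ A∩ x
    A∩[y-x]+x {b} b∈ = A∩-resp (solve 1 (λ b x → b :- :- x := b :+ x) b x)
      (rigid x∈D (proj₂ (partner y-x∈D y-x∉K))
        (λ {a} a∈A∩x@(a∈A , a-x∈A) → a-x∈A ,
          A-resp (solve 2 (λ a x y → a :- y := (a :- x) :- (y :- x)) a x y)
                 (proj₂ (common-partner x#z y#z a∈A∩x)))
        b∈)

    module _ {e} (e∈D : e ∈ D) (e∉K : e ∉ K)
             (x-e∈D : x - e ∈ D) (y-e∈D : y - e ∈ D) (z-e∈D : z - e ∈ D) where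

      translate : ∀ {w} → w - z ∉ D → w - e ∈ D → w - e # z - e
      translate {w} w-z∉D w-e∈D = w-e∈D , z-e∈D , λ d →
        w-z∉D (D-resp (solve 2 (λ w z e → (w :- e) :- (z :- e) := w :- z) w z e) d)

      -- As `x - e` and `y - e` share the partner `z - e`, the point `a` also lies in `A∩ (y - e)`.
      -- Hence `a - (x - e)` lies in `A∩ (y - x)`, and translation by `x` carries it to `a + e` in
      -- `A∩ x`.
      A∩[x-e]+e : ∀ {a} → a ∈ A∩ (x - e) → a + e ∈ A∩ x
      A∩[x-e]+e {a} a∈A∩x-e@(_ , b∈A) =
        A∩-resp (solve 2 (λ a x e → (a :- (x :- e)) :+ x := a :+ e) a x e)
          (A∩[y-x]+x (b∈A ,
            A-resp (solve 3 (λ a x y e → a :- (y :- e) := (a :- (x :- e)) :- (y :- x)) a x y e)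
              (proj₂ (common-partner (translate x-z∉D x-e∈D) (translate y-z∉D y-e∈D) a∈A∩x-e))))

      -- By `rigid`, translation by `- e` maps `A∩ x` back into `A∩ (x - e)`, so `b - e` lies in
      -- `A`.
      A∩x⊆A∩e : A∩ x ⊆ A∩ e
      A∩x⊆A∩e b∈A∩x@(b∈A , _) = b∈A , proj₁ (rigid x-e∈D x#z A∩[x-e]+e b∈A∩x)

      A∩e⊆A∩x : A∩ e ⊆ A∩ x
      A∩e⊆A∩x {b} b∈A∩e = A∩-resp (solve 0 (λ b → b :- :0 := b) b)
        -- With shift zero, `rigid` turns an inclusion of halves into an equality; `A∩ e` is a half
        -- because `e` has a partner.
        (rigid {t = 0#} x∈D (proj₂ (partner e∈D e∉K))
          (λ a∈A∩x → A∩x⊆A∩e (A∩-resp (sym (identityʳ _)) a∈A∩x)) b∈A∩e)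

    -- If `e` is a partner of `x`, `y` or `z`, then comparing complements suffices. Otherwise
    -- `x - e`, `y - e` and `z - e` all lie in `D`, and the translation argument applies.
    dichotomy : ∀ {e} → e ∈ D → e ∉ K → A∩ e ≐ A∩ x ⊎ A∩ e ≐ A∩ z
    dichotomy {e} e∈D e∉K with #? x e | #? y e | #? z e
    ... | yes x#e | _ | _ = inj₂ (common-partner-≐ (#-sym x#e) (#-sym x#z))
    ... | no _ | yes y#e | _ = inj₂ (common-partner-≐ (#-sym y#e) (#-sym y#z))
    ... | no _ | no _ | yes z#e = inj₁ (common-partner-≐ (#-sym z#e) x#z)
    ... | no ¬x#e | no ¬y#e | no ¬z#e = inj₁
      (A∩e⊆A∩x e∈D e∉K x-e∈D y-e∈D z-e∈D , A∩x⊆A∩e e∈D e∉K x-e∈D y-e∈D z-e∈D)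
      where
      x-e∈D = not-#⇒difference x∈D e∈D ¬x#e
      y-e∈D = not-#⇒difference y∈D e∈D ¬y#e
      z-e∈D = not-#⇒difference z∈D e∈D ¬z#e

  -- The dichotomy when partners are unique modulo `K`.

  K-halve : ∀ {h} → h + h ∈ K → h ∈ K
  K-halve = halve K? K≤G

  module _ (unique : ∀ {x y z} → x # z → y # z → x - y ∈ K) where

    -- As D is symmetric about 0 and y + K about y, both have odd size, so
    -- D ∖ (y + K) has even size.  But uniqueness makes it symmetric about h,
    -- which it contains.
    double-without-partner : ∀ {h y} → h ∈ D → ¬ (h + h # y)
    double-without-partner {h} {y} h∈D 2h#y@(2h∈D , y∈D , 2h-y∉D) =
      contradiction (≡.trans (≡.sym odd) even) λ ()
      where
      Coset Rest : Pred Carrier _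
      Coset a = a - y ∈ K
      Rest a = a ∈ D × a ∉ Coset

      coset? : Decidable Coset
      coset? a = K? (a - y)

      rest? : Decidable Rest
      rest? a = D? a ×-dec ¬? (coset? a)

      coset-resp : Coset Respects _≈_
      coset-resp = K-resp ∘ ∙-congʳ

      coset⊆D : Coset ⊆ D
      coset⊆D {a} a-y∈K = D-resp (solve 1 (λ a y → y :+ (a :- y) := a) a y) (D+K y∈D a-y∈K)

      -- By uniqueness the partners of `2h` lie in `y + K`, so `a` is none of them and `2h - a` is
      -- in `D`. If `2h - a` were in `y + K`, then `2h - y` would be in `a + K`, hence in `D`.
      rest-symmetric : ∀ {a} → a ∈ Rest → h + h - a ∈ Rest
      rest-symmetric {a} (a∈D , a∉y+K) =
        not-#⇒difference 2h∈D a∈D (λ 2h#a → a∉y+K (unique (#-sym 2h#a) (#-sym 2h#y))) ,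
        λ k → 2h-y∉D (D-resp
          (solve 2 (λ h a y → a :+ (((h :+ h) :- a) :- y) := (h :+ h) :- y) h a y)
          (D+K a∈D k))

      h∈Rest : h ∈ Rest
      h∈Rest = h∈D , λ k → 2h-y∉D (D-resp
        (solve 1 (λ h y → h :+ (h :- y) := (h :+ h) :- y) h y) (D+K h∈D k))

      odd : parity rest? ≡ true
      odd = parity-centred rest?
        (λ a≈b (a∈D , a∉y+K) → D-resp a≈b a∈D , a∉y+K ∘ coset-resp (sym a≈b))
        rest-symmetric h∈Rest refl

      odd-D : parity D? ≡ true
      odd-D = parity-centred D? D-resp
        (λ a∈D → D-resp (sym (identityˡ _)) (D-neg a∈D)) 0∈D (identityˡ 0#)

      odd-coset : parity coset? ≡ true
      odd-coset = parity-centred coset? coset-resp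
        (λ {a} k → K-resp (solve 1 (λ a y → :- (a :- y) := ((y :+ y) :- a) :- y) a y) (K-neg k))
        (K-resp (sym (inverseʳ y)) 0∈K) refl

      even : parity rest? ≡ false
      even = xor-cancel (parity rest?) (parity coset?)
        (≡.trans (≡.sym odd-D) (parity-⊎ rest? coset? D? proj₁ coset⊆D proj₂ _,_)) odd-coset
        where
        xor-cancel : ∀ a b → true ≡ a xor b → b ≡ true → a ≡ false
        xor-cancel false _     _  _      = ≡.refl
        xor-cancel true  true  () _
        xor-cancel true  false _  ()

    -- Since `h` is not in `K`, neither is `2h`; if it were in `D` it would have a partner, which
    -- the parity count forbids.
    double∉D : ∀ {h} → h ∈ D → h ∉ K → h + h ∉ D
    double∉D h∈D h∉K 2h∈D =
      let (_ , 2h#y) = partner 2h∈D (h∉K ∘ K-halve) in double-without-partner h∈D 2h#y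

    unique-partners⇒dichotomy : ∀ {h} → h ∈ D → h ∉ K → ∃₂ Dichotomy
    unique-partners⇒dichotomy {h} h∈D h∉K = h , - h , h#-h , dichotomy
      where
      opposite : ∀ {x} → x ∈ D → x ∉ K → x # - x
      opposite {x} x∈D x∉K = x∈D , D-neg x∈D , λ d →
        double∉D x∈D x∉K (D-resp (solve 0 (λ x → x :- :- x := x :+ x) x) d)

      h#-h : h # - h
      h#-h = opposite h∈D h∉K

      open Periodic h#-h

      module _ {e} (e∈D : e ∈ D) (e∉K : e ∉ K) (e-h∉K : e - h ∉ K) (e+h∉K : e - - h ∉ K) where

        -- If `e # h`, then `e` and `- h` are both partners of `h`, and uniqueness puts `e + h` in
        -- `K`.
        e-h∈D : e - h ∈ D
        e-h∈D = not-#⇒difference e∈D h∈D λ e#h → e+h∉K (unique e#h (#-sym h#-h))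

        e+h∈D : e - - h ∈ D
        e+h∈D = not-#⇒difference e∈D (D-neg h∈D) λ e#-h → e-h∉K (unique e#-h h#-h)

        impossible : ⊥
        impossible = h∉K (K-halve (K-resp
          (solve 1 (λ e h → :- (e :- h) :- :- (e :- :- h) := h :+ h) e h)
          (unique
            (D-neg e-h∈D , e+h∈D , λ d → double∉D e∈D e∉K (D-resp
               (solve 1 (λ e h → :- (:- (e :- h) :- (e :- :- h)) := e :+ e) e h) (D-neg d)))
            (#-sym (opposite e+h∈D e+h∉K)))))

      dichotomy : ∀ {e} → e ∈ D → e ∉ K → A∩ e ≐ A∩ h ⊎ A∩ e ≐ A∩ (- h)
      dichotomy {e} e∈D e∉K with K? (e - h) | K? (e - - h)
      ... | yes e-h∈K | _         = inj₁ (A∩-≐ e-h∈K)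
      ... | no  _     | yes e+h∈K = inj₂ (A∩-≐ e+h∈K)
      ... | no  e-h∉K | no  e+h∉K = ⊥-elim (impossible e∈D e∉K e-h∉K e+h∉K)

  TwoPartners : Set (c ⊔ ℓ ⊔ p)
  TwoPartners = ∃ λ z → ∃₂ λ x y → x # z × y # z × x - y ∉ K

  twoPartners? : Dec TwoPartners
  twoPartners? = ∃?
    (λ z → ∃?
      (λ x → ∃?
        (λ y → #? x z ×-dec #? y z ×-dec ¬? (K? (x - y)))
        (λ y≈y′ (x#z , y#z , x-y∉K) → x#z , #-resp y≈y′ refl y#z ,
          x-y∉K ∘ K-resp (∙-congˡ (⁻¹-cong (sym y≈y′)))))
      (λ x≈x′ (y , x#z , y#z , x-y∉K) → y , #-resp x≈x′ refl x#z , y#z ,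
        x-y∉K ∘ K-resp (∙-congʳ (sym x≈x′))))
    (λ z≈z′ (x , y , x#z , y#z , x-y∉K) →
      x , y , #-resp refl z≈z′ x#z , #-resp refl z≈z′ y#z , x-y∉K)

  dichotomy-exists : ∀ {h} → h ∈ D → h ∉ K → ∃₂ Dichotomy
  dichotomy-exists h∈D h∉K = case twoPartners? of λ where
    (yes (z , x , y , x#z , y#z , x-y∉K)) → x , z , two-partners⇒dichotomy x#z y#z x-y∉K
    (no unique) → unique-partners⇒dichotomy
      (λ {x} {y} {z} x#z y#z → decidable-stable (K? (x - y))
        λ x-y∉K → unique (z , x , y , x#z , y#z , x-y∉K))
      h∈D h∉K

  -- From the dichotomy to single cosets.

  module Cosets {x z} (x#z : x # z)
                (dichotomy : ∀ {e} → e ∈ D → e ∉ K → A∩ e ≐ A∩ x ⊎ A∩ e ≐ A∩ z) where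
    open Periodic x#z

    -- The element `s` lies in `A∩ (s - u)` as well as in `A∩ x`, which is disjoint from `A∩ z`;
    -- this rules out the second alternative of the dichotomy.
    A∩-difference : ∀ {s u} → s ∈ A∩ x → u ∈ A → s - u ∉ K → A∩ (s - u) ≐ A∩ x
    A∩-difference {s} {u} s∈A∩x@(s∈A , _) u∈A s-u∉K =
      [ (λ same → same)
      , (λ same → contradiction (proj₁ same s∈A∩[s-u]) (disjoint x#z s∈A∩x))
      ]′ (dichotomy (difference∈D s∈A u∈A) s-u∉K)
      where
      s∈A∩[s-u] : s ∈ A∩ (s - u)
      s∈A∩[s-u] = s∈A , A-resp (solve 1 (λ s u → u := s :- (s :- u)) s u) u∈A

    -- Otherwise periodicity would carry `s - x` to `u - x` within `A`, and `u` would lie in both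
    -- halves.
    across∉K : ∀ {s u} → s ∈ A∩ x → u ∈ A∩ z → s - u ∉ K
    across∉K {s} {u} (s∈A , s-x∈A) u∈A∩z@(u∈A , _) s-u∈K = disjoint x#z
      (u∈A , A-resp (solve 2 (λ s u x → (s :- x) :- (s :- u) := u :- x) s u x)
               (A+K s-x∈A (K-neg s-u∈K)))
      u∈A∩z

    -- If s - s′ ∉ K then A∩ (s - s′) = A∩ x, and this set contains u because
    -- u - (s - s′) = s′ - (s - u) lies in A, by A∩ (s - u) = A∩ x.
    within∈K : ∀ {s s′ u} → s ∈ A∩ x → s′ ∈ A∩ x → u ∈ A∩ z → s - s′ ∈ K
    within∈K {s} {s′} {u} s∈A∩x s′∈A∩x u∈A∩z@(u∈A , _) =
      decidable-stable (K? (s - s′)) λ s-s′∉K → disjoint x#z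
        (proj₁ (A∩-difference s∈A∩x (proj₁ s′∈A∩x) s-s′∉K)
          (u∈A , A-resp (solve 2 (λ s s′ u → s′ :- (s :- u) := u :- (s :- s′)) s s′ u)
                   (proj₂ (proj₂ (A∩-difference s∈A∩x u∈A (across∉K s∈A∩x u∈A∩z)) s′∈A∩x))))
        u∈A∩z

  A∩-inhabited : ∀ {x} → x ∈ D → Satisfiable (A∩ x)
  A∩-inhabited {x} (a , b , a∈A , b∈A , x≈a-b) = a , a∈A ,
    A-resp (trans (solve 1 (λ a b → b := a :- (a :- b)) a b) (∙-congˡ (⁻¹-cong (sym x≈a-b)))) b∈A

  -- The difference set of two cosets, and the order of `g` modulo `K`.

  module TwoCosets
    {s u} (s∈A : s ∈ A) (u∈A : u ∈ A) (s-u∉K : s - u ∉ K)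
    (A+K : ∀ {a k} → a ∈ A → k ∈ K → a + k ∈ A)
    (A-cosets : ∀ {a} → a ∈ A → a - u ∈ K ⊎ a - s ∈ K)
    where

    g : Carrier
    g = s - u

    A≐ : A ≐ (u +ᶜ K) ∪ ((u + g) +ᶜ K)
    A≐ = (λ {a} a∈A →
            [ (λ k → inj₁ (a - u , k , solve 1 (λ a u → a := u :+ (a :- u)) a u))
            , (λ k → inj₂ (a - s , k , solve 2 (λ a s u → a := (u :+ (s :- u)) :+ (a :- s)) a s u))
            ]′ (A-cosets a∈A))
       , [ (λ (_ , k , eq) → A-resp (sym eq) (A+K u∈A k))
         , (λ (h , k , eq) → A-resp
             (trans (solve 2 (λ h s u → s :+ h := (u :+ (s :- u)) :+ h) h s u) (sym eq))
             (A+K s∈A k))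
         ]′

    g∈D : g ∈ D
    g∈D = difference∈D s∈A u∈A

    D-cosets : ∀ {d} → d ∈ D → d + g ∈ K ⊎ d ∈ K ⊎ d - g ∈ K
    D-cosets {d} (a , b , a∈A , b∈A , d≈a-b) = case A-cosets a∈A , A-cosets b∈A of λ where
        (inj₁ a-u , inj₁ b-u) → inj₂ (inj₁ (at
          (solve 2 (λ a b u → (a :- u) :- (b :- u) := a :- b) a b u)
          d≈a-b (K-- a-u b-u)))
        (inj₁ a-u , inj₂ b-s) → inj₁ (at
          (solve 3 (λ a b s u → (a :- u) :- (b :- s) := (a :- b) :+ (s :- u)) a b s u)
          (∙-congʳ d≈a-b) (K-- a-u b-s))
        (inj₂ a-s , inj₁ b-u) → inj₂ (inj₂ (at
          (solve 3 (λ a b s u → (a :- s) :- (b :- u) := (a :- b) :- (s :- u)) a b s u)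
          (∙-congʳ d≈a-b) (K-- a-s b-u)))
        (inj₂ a-s , inj₂ b-s) → inj₂ (inj₁ (at
          (solve 2 (λ a b s → (a :- s) :- (b :- s) := a :- b) a b s)
          d≈a-b (K-- a-s b-s)))
      where
      K-- : ∀ {h k} → h ∈ K → k ∈ K → h - k ∈ K
      K-- h∈K k∈K = K-+ h∈K (K-neg k∈K)

      at : ∀ {x y z} → x ≈ y → z ≈ y → x ∈ K → z ∈ K
      at x≈y z≈y = K-resp (trans x≈y (sym z≈y))

    -g+K⊆D : ∀ {d} → d + g ∈ K → d ∈ D
    -g+K⊆D {d} k = D-resp (solve 1 (λ d g → :- g :+ (d :+ g) := d) d g) (D+K (D-neg g∈D) k)

    g+K⊆D : ∀ {d} → d - g ∈ K → d ∈ D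
    g+K⊆D {d} k = D-resp (solve 1 (λ d g → g :+ (d :- g) := d) d g) (D+K g∈D k)

    D≐ : D ≐ ((- g) +ᶜ K) ∪ K ∪ (g +ᶜ K)
    D≐ = (λ {d} d∈D →
            [ (λ k → inj₁ (d + g , k , solve 1 (λ d g → d := :- g :+ (d :+ g)) d g))
            , [ (λ k → inj₂ (inj₁ k))
              , (λ k → inj₂ (inj₂ (d - g , k , solve 1 (λ d g → d := g :+ (d :- g)) d g)))
              ]′
            ]′ (D-cosets d∈D))
       , [ (λ (_ , k , eq) → D-resp (sym eq) (D+K (D-neg g∈D) k))
         , [ K⊆D
           , (λ (_ , k , eq) → D-resp (sym eq) (D+K g∈D k))
           ]′
         ]′

    -- If `3g` were in `K`, adding `g` would permute the cosets `- g + K`, `K` and `g + K`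
    -- cyclically. Then `g` would stabilise their union `D`, although it is not in `K`.
    3g∉K : g + (g + g) ∉ K
    3g∉K 3g∈K = s-u∉K (K-intro
      (λ {x} x∈D →
        [ (λ k → K⊆D k)
        , [ (λ k → g+K⊆D (K-resp (solve 1 (λ x g → x := (x :+ g) :- g) x g) k))
          , (λ k → -g+K⊆D (K-resp
              (solve 1 (λ x g → (x :- g) :+ (g :+ (g :+ g)) := (x :+ g) :+ g) x g)
              (K-+ k 3g∈K)))
          ]′
        ]′ (D-cosets x∈D))
      (λ {x} x∈D →
        [ (λ k → g+K⊆D (K-resp
            (solve 1 (λ x g → (x :+ g) :- (g :+ (g :+ g)) := (x :- g) :- g) x g)
            (K-+ k (K-neg 3g∈K))))
        , [ (λ k → -g+K⊆D (K-resp (solve 1 (λ x g → x := (x :- g) :+ g) x g) k))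
          , (λ k → K⊆D k)
          ]′
        ]′ (D-cosets x∈D)))

    -- Oddness comes from `K-halve`, by which the quotient has no element of order two; the orders
    -- one and three are excluded because neither `g` nor `3g` is in `K`.
    order : ∃ λ k → IsOrder (quotient K≤G) g k × Odd k × 5 ≤ k
    order =
      let (k , k-order) = order-exists (Inverse.to finite)
            (λ eq → K-resp (sym (x≈y⇒x∙y⁻¹≈ε (to-injective eq))) 0∈K) (λ x → K? (x - 0#)) g
          k-odd = order-odd k-order (λ 2x∈K → K-resp (sym (x-0≈x _)) (K-halve (K-resp (x-0≈x _) 2x∈K)))
      in k , k-order , k-odd , order≥5 k-order k-odd
           (λ g∈K → s-u∉K (K-resp (x-0≈x g) g∈K))
           (λ 3g∈K → 3g∉K (K-resp (solve 0 (λ g → (g :+ (g :+ (g :+ :0))) :- :0 := g :+ (g :+ g)) g) 3g∈K))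
      where
      open Orders (quotient K≤G)
      open AbelianGroupProperties G using (x≈y⇒x∙y⁻¹≈ε)
      -- Being zero in the quotient unfolds to `x - 0# ∈ K`, so this identity translates to and from
      -- membership in `K`.
      x-0≈x : ∀ x → x - 0# ≈ x
      x-0≈x = solve 0 (λ x → x :- :0 := x)

  -- Assembling the two alternatives.

  Conclusion : Set _
  Conclusion = Σ[ H ∈ Pred Carrier p ] Σ[ H≤G ∈ IsSubgroup H ] Decidable H ×
    (∃[ x ] ∃[ g ]
      A ≐ (x +ᶜ H) ∪ ((x + g) +ᶜ H)
      × A ⊖ A ≐ ((- g) +ᶜ H) ∪ H ∪ (g +ᶜ H)
      × (∃[ k ] IsOrder (quotient H≤G) g k × Odd k × 5 ≤ k))

  dichotomy⇒conclusion : ∀ {x z} → Dichotomy x z → Conclusion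
  dichotomy⇒conclusion {x} {z} (x#z@(x∈D , z∈D , _) , dichotomy) =
    let (s , s∈A∩x) = A∩-inhabited x∈D
        (u , u∈A∩z) = A∩-inhabited z∈D
        open Cosets x#z dichotomy using (across∉K; within∈K)
        -- The hypotheses are symmetric in `x` and `z`, so the same argument shows that `A∩ z` lies
        -- in a single coset.
        open Cosets (#-sym x#z) (λ e∈D e∉K → swap (dichotomy e∈D e∉K)) using ()
          renaming (within∈K to within∈K′)
        open TwoCosets (proj₁ s∈A∩x) (proj₁ u∈A∩z) (across∉K s∈A∩x u∈A∩z) (Periodic.A+K x#z)
          (λ a∈A → [ (λ a∈A∩x → inj₂ (within∈K a∈A∩x s∈A∩x u∈A∩z))
                   , (λ a∈A∩z → inj₁ (within∈K′ a∈A∩z u∈A∩z s∈A∩x))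
                   ]′ (cover x#z a∈A))
    in K , K≤G , K? , u , g , A≐ , D≐ , order

  subgroup-or-two-cosets : IsSubgroup (A ⊖ A) ⊎ Conclusion
  subgroup-or-two-cosets =
    case ∃? (λ x → D? x ×-dec ¬? (K? x))
            (λ x≈y (x∈D , x∉K) → D-resp x≈y x∈D , x∉K ∘ K-resp (sym x≈y)) of λ where
      (yes (_ , x∈D , x∉K)) → inj₂ (dichotomy⇒conclusion (proj₂ (proj₂ (dichotomy-exists x∈D x∉K))))
      -- Here `D` is contained in its own stabiliser, hence closed under addition.
      (no  D∖K-empty)       → inj₁ (D⊆K⇒subgroup λ {x} x∈D →
        decidable-stable (K? x) λ x∉K → D∖K-empty (x , x∈D , x∉K))

corollary1p3 : {c ℓ p : Level} (G : AbelianGroup c ℓ) →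
    let open Subsets G in
    (n : ℕ) (finite : HasCardinality setoid n) → Odd n →
    let open Counting finite in
    (A : Pred Carrier p) (A? : Decidable A) → A Respects _≈_ →
    Satisfiable A →
    (∀ d → d ∈ A ⊖ A → ∣ A? ∣ ≤ 2 * r A? d) →
    IsSubgroup (A ⊖ A)
    ⊎ (Σ[ H ∈ Pred Carrier p ] Σ[ H≤G ∈ IsSubgroup H ] Decidable H ×
    (∃[ x ] ∃[ g ]
    A ≐ (x +ᶜ H) ∪ ((x + g) +ᶜ H)
    × A ⊖ A ≐ ((- g) +ᶜ H) ∪ H ∪ (g +ᶜ H)
    × (∃[ k ] IsOrder (quotient H≤G) g k × Odd k × 5 ≤ k)))
corollary1p3 G n finite n-odd A A? A-resp A-nonempty half =
  HalfPopular.subgroup-or-two-cosets G n finite n-odd A A? A-resp A-nonempty half
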